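{- Let $G=(V,E)$ be an instance of unweighted, complete correlation clustering and suppose that the subgraph formed by the positive edges $E^+$ is regular. Then the fractional cost of the correlation metric $d$ in the $\ell_1$-norm objective is within a constant factor of $\mathsf{OPT}(1)$: $$\sum_{u\in V}\sum_{v\in N_u^+} d_{uv} + \sum_{u\in V}\sum_{v\in N_u^- }(1-d_{uv}) = O(\mathsf{OPT}(1)).$$ Consequently, the clustering produced by the KMZ rounding algorithm with input $d$ is a constant-factor approximation simultaneously for the $\ell_1$-norm and the $\ell_\infty$-norm objectives.
   Context: An instance is a complete graph $G=(V,E)$, $|V|=n$, with every edge labeled positive ($+$, set $E^+$) or negative ($-$, set $E^-$); by convention every vertex has a positive self-loop. $N_u^+=\{v:(u,v)\in E^+\}$ (so $u\in N_u^+$) and $N_u^-=\{v:(u,v)\in E^-\}$. A clustering is a partition of $V$; a positive edge is a disagreement if its endpoints are in different clusters, a negative edge if its endpoints are in the same cluster; $y_{\mathcal{C}}(u)$ is the number of disagreements at $u$, and $\mathsf{OPT}(p)=\min_{\mathcal{C}}\lVert y_{\mathcal{C}}\rVert_p$. The correlation metric is $d_{uv}=1-\frac{|N_u^+\cap N_v^+|}{|N_u^+\cup N_v^+|}$ for $u,v\in V$. The KMZ rounding algorithm, given a semi-metric $z$ on $V$: set $r=1/5$, $V_0=V$, $t=0$; while $V_t\neq\emptyset$, let $\mathrm{Ball}(u,\rho)=\{v: z_{uv}\le\rho\}$, pick $u_t^*\in\arg\max_{u\in V_t}\sum_{v\in \mathrm{Ball}(u,r)\cap V_t}(r-z_{uv})$,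 create cluster $C_t=\mathrm{Ball}(u_t^*,2r)\cap V_t$, set $V_{t+1}=V_t\setminus C_t$ and $t\leftarrow t+1$; output $(C_0,\dots,C_{t-1})$. -}

module Defs where

open import Data.Bool using (Bool; true; false; _∧_; _∨_; not; if_then_else_)
open import Data.Nat as ℕ using (ℕ; zero; suc; _⊔_)
open import Data.Fin using (Fin; zero; suc; _≟_)
open import Relation.Nullary using (does)
open import Data.Fin.Subset using (Subset; _∈_; _∩_; _∪_; ∣_∣; _─_; Empty)
open import Data.Vec using (tabulate; lookup)
open import Data.Integer using (+_)
open import Data.Rational as ℚ using (ℚ; 0ℚ; 1ℚ; _≤ᵇ_)
open import Data.Product using (Σ; _×_)
open import Relation.Binary.PropositionalEquality using (_≡_)

sumℕ : ∀ {n} → (Fin n → ℕ) → ℕ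
sumℕ {zero}  f = 0
sumℕ {suc n} f = f zero ℕ.+ sumℕ (λ i → f (suc i))

maxℕ : ∀ {n} → (Fin n → ℕ) → ℕ
maxℕ {zero}  f = 0
maxℕ {suc n} f = f zero ⊔ maxℕ (λ i → f (suc i))

sumℚ : ∀ {n} → (Fin n → ℚ) → ℚ
sumℚ {zero}  f = 0ℚ
sumℚ {suc n} f = f zero ℚ.+ sumℚ (λ i → f (suc i))

sumℚ-over : ∀ {n} → Subset n → (Fin n → ℚ) → ℚ
sumℚ-over S f = sumℚ (λ v → if lookup S v then f v else 0ℚ)

-- Instances of complete, unweighted correlation clustering on vertex
-- set Fin n.  sign u v = true  means (u,v) ∈ E⁺, false means (u,v) ∈ E⁻.

record Instance (n : ℕ) : Set where
  field
    sign     : Fin n → Fin n → Bool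
    symmetric : ∀ u v → sign u v ≡ sign v u
    selfLoop : ∀ u → sign u u ≡ true
open Instance public

N⁺ : ∀ {n} → Instance n → Fin n → Subset n
N⁺ G u = tabulate (λ v → sign G u v)

N⁻ : ∀ {n} → Instance n → Fin n → Subset n
N⁻ G u = tabulate (λ v → not (sign G u v))

PositiveRegular : ∀ {n} → Instance n → Set
PositiveRegular {n} G = Σ ℕ (λ k → ∀ (u : Fin n) → ∣ N⁺ G u ∣ ≡ k)

-- Clusterings.  A clustering is given by its "same cluster" relation
-- sc u v = true iff u and v lie in the same cluster.

disagree : ∀ {n} → Instance n → (Fin n → Fin n → Bool) → Fin n → ℕ
disagree G sc u =
  sumℕ (λ v → if (sign G u v ∧ not (sc u v)) ∨ (not (sign G u v) ∧ sc u v)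
              then 1 else 0)

ℓ₁ : ∀ {n} → Instance n → (Fin n → Fin n → Bool) → ℕ
ℓ₁ G sc = sumℕ (disagree G sc)

ℓ∞ : ∀ {n} → Instance n → (Fin n → Fin n → Bool) → ℕ
ℓ∞ G sc = maxℕ (disagree G sc)

-- Every partition of Fin n is given by a labelling Fin n → Fin n
-- (u and v in the same cluster iff same label), and conversely.
labelSC : ∀ {n} → (Fin n → Fin n) → Fin n → Fin n → Bool
labelSC lab u v = does (lab u ≟ lab v)

-- Correlation metric  d_uv = 1 - |N⁺u ∩ N⁺v| / |N⁺u ∪ N⁺v|
-- (the union always contains u, so it is nonempty; the zero case is
-- never used)

ratio : ℕ → ℕ → ℚ
ratio a zero    = 0ℚ
ratio a (suc b) = (+ a) ℚ./ suc b

corr : ∀ {n} → Instance n → Fin n → Fin n → ℚ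
corr G u v = 1ℚ ℚ.- ratio ∣ N⁺ G u ∩ N⁺ G v ∣ ∣ N⁺ G u ∪ N⁺ G v ∣

fracCost : ∀ {n} → Instance n → (Fin n → Fin n → ℚ) → ℚ
fracCost G z =
  sumℚ (λ u → sumℚ-over (N⁺ G u) (λ v → z u v))
  ℚ.+ sumℚ (λ u → sumℚ-over (N⁻ G u) (λ v → 1ℚ ℚ.- z u v))

-- KMZ rounding algorithm (with arbitrary tie-breaking in the argmax),
-- described as a relation between the current vertex set V_t and the
-- list of clusters it outputs.

r : ℚ
r = (+ 1) ℚ./ 5

Ball : ∀ {n} → (Fin n → Fin n → ℚ) → Fin n → ℚ → Subset n
Ball z u ρ = tabulate (λ v → z u v ≤ᵇ ρ)

score : ∀ {n} → (Fin n → Fin n → ℚ) → Subset n → Fin n → ℚ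
score z Vt u = sumℚ-over (Ball z u r ∩ Vt) (λ v → r ℚ.- z u v)

open import Data.List using (List; []; _∷_)

data KMZRun {n : ℕ} (z : Fin n → Fin n → ℚ) : Subset n → List (Subset n) → Set where
  done : ∀ {Vt} → Empty Vt → KMZRun z Vt []
  step : ∀ {Vt rest} (u : Fin n) → u ∈ Vt →
         (∀ w → w ∈ Vt → score z Vt w ℚ.≤ score z Vt u) →
         KMZRun z (Vt ─ (Ball z u (r ℚ.+ r) ∩ Vt)) rest →
         KMZRun z Vt ((Ball z u (r ℚ.+ r) ∩ Vt) ∷ rest)

clustersSC : ∀ {n} → List (Subset n) → Fin n → Fin n → Bool
clustersSC []       u v = false
clustersSC (C ∷ Cs) u v = (lookup C u ∧ lookup C v) ∨ clustersSC Cs u v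

{-# OPTIONS --safe #-}
module Submission where

-- Let k be the common positive degree, e(u,v) = |N⁺u ∖ N⁺v|, and let y be the disagreements of any
-- clustering.  Regularity gives d = 2e/(k + e) and 1 - d = (k - e)/(k + e), so k d ≤ min(2e, k) and
-- k (1 - d) ≤ min(|N⁺u ∩ N⁺v|, k).  If u, v share a cluster, every w ∈ N⁺u ∖ N⁺v is in disagreement
-- with u or v; if they do not, every w ∈ N⁺u ∩ N⁺v is.  Summing over v, the fractional cost of u is
-- at most 4 y(u) + (3/k) Σ_{w ∈ N⁺u} y(w), which is at most 7 ‖y‖∞ and sums to 7 ‖y‖₁.
--
-- Since x ↦ 2x/(k + x) is subadditive and e satisfies the triangle inequality, d is a semi-metric.
-- For any semi-metric z ≤ 1, KMZ rounding costs each vertex at most 1/r = 5 times its fractional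
-- cost: when a ball is carved out, the edges at u settled in that step pay for themselves, because
-- the loss on edges shorter than r is at most the score of u, and the edges from u into the
-- r-ball of the centre w gain at least the score of w, which is the maximal one.

open import Defs

-- Rounding a semi-metric by carving balls.

module Rounding where

  open import Data.Bool using (Bool; true; false; _∧_; _∨_; not; if_then_else_)
  open import Data.Bool.Properties using (T-≡; ∧-zeroʳ; ∧-identityʳ; ∨-identityʳ)
  open import Data.Fin using (Fin; zero; suc)
  open import Data.Fin.Subset using (Subset; _∩_; _─_)
  open import Data.List using (List; _∷_; [])
  open import Data.Maybe using (Maybe; just; nothing)
  open import Data.Nat using (ℕ; zero; suc)
  open import Data.Product using (_,_)
  open import Data.Rational
  open import Data.Rational.Properties
  open import Data.Sum as Sum using (_⊎_; inj₁; inj₂)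
  open import Data.Vec using (lookup)
  open import Data.Vec.Properties using (lookup-zipWith; lookup∘tabulate; lookup⇒[]=)
  open import Function.Bundles using (Equivalence)
  open import Level using (0ℓ)
  open import Relation.Nullary using (yes; no)
  open import Relation.Binary.PropositionalEquality
  open import Tactic.RingSolver using (solve; solve-∀)
  open import Tactic.RingSolver.Core.AlmostCommutativeRing using (AlmostCommutativeRing; fromCommutativeRing)

  ring : AlmostCommutativeRing 0ℓ 0ℓ
  ring = fromCommutativeRing +-*-commutativeRing isZero
    where
    isZero : ∀ p → Maybe (0ℚ ≡ p)
    isZero p with 0ℚ ≟ p
    ... | yes eq = just eq
    ... | no _ = nothing

  -- Linear arithmetic: x ≤ y is the hypothesis a ≤ b up to rearrangement, which the ring solver checks.
  -- x and y are explicit so that the solver sees them in unfolded form.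
  lin : ∀ {a b} x y → a ≤ b → y + a ≡ x + b → x ≤ y
  lin x y a≤b eq = ≮⇒≥ λ y<x → <⇒≢ (+-mono-<-≤ y<x a≤b) eq

  ≤ᵇ-true : ∀ {p q} → (p ≤ᵇ q) ≡ true → p ≤ q
  ≤ᵇ-true eq = ≤ᵇ⇒≤ (Equivalence.from T-≡ eq)

  ≤ᵇ-false : ∀ {p q} → (p ≤ᵇ q) ≡ false → q ≤ p
  ≤ᵇ-false {p} {q} eq with ≤-total p q
  ... | inj₂ q≤p = q≤p
  ... | inj₁ p≤q with trans (sym eq) (Equivalence.to T-≡ (≤⇒≤ᵇ p≤q))
  ...   | ()

  mask : Bool → ℚ → ℚ
  mask b p = if b then p else 0ℚ

  sumℚ-mono : ∀ {n} {f g : Fin n → ℚ} → (∀ i → f i ≤ g i) → sumℚ f ≤ sumℚ g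
  sumℚ-mono {zero}  h = ≤-refl
  sumℚ-mono {suc n} h = +-mono-≤ (h zero) (sumℚ-mono (λ i → h (suc i)))

  sumℚ-cong : ∀ {n} {f g : Fin n → ℚ} → (∀ i → f i ≡ g i) → sumℚ f ≡ sumℚ g
  sumℚ-cong {zero}  h = refl
  sumℚ-cong {suc n} h = cong₂ _+_ (h zero) (sumℚ-cong (λ i → h (suc i)))

  +-interchange : ∀ a b c d → (a + b) + (c + d) ≡ (a + c) + (b + d)
  +-interchange = solve-∀ ring

  sumℚ-distrib-+ : ∀ {n} (f g : Fin n → ℚ) → sumℚ (λ i → f i + g i) ≡ sumℚ f + sumℚ g
  sumℚ-distrib-+ {zero}  f g = refl
  sumℚ-distrib-+ {suc n} f g =
    trans (cong (f zero + g zero +_) (sumℚ-distrib-+ (λ i → f (suc i)) (λ i → g (suc i))))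
          (+-interchange (f zero) (g zero) _ _)

  0≤r : 0ℚ ≤ r
  0≤r = ≤ᵇ⇒≤ _

  -- The account of a single edge.

  conflict : Bool → Bool → Bool
  conflict s c = (s ∧ not c) ∨ (not s ∧ c)

  -- A disagreement costs `r` rather than 1, so that the loss factor `1/r` of the rounding turns
  -- into a plain comparison of payment with budget.
  pay : Bool → Bool → ℚ
  pay s c = if conflict s c then r else 0ℚ

  lp : Bool → ℚ → ℚ
  lp s z = if s then z else 1ℚ - z

  -- The positive part of `r - z`, which is the summand of the KMZ score.
  gap : ℚ → ℚ
  gap z = mask (z ≤ᵇ r) (r - z)

  gap-nonneg : ∀ z → 0ℚ ≤ gap z
  gap-nonneg z with z ≤ᵇ r in eq
  ... | true  = lin 0ℚ (r - z) (≤ᵇ-true {z} {r} eq) (solve (z ∷ []) ring)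
  ... | false = ≤-refl

  r≤gap+ : ∀ z → r ≤ gap z + z
  r≤gap+ z with z ≤ᵇ r in eq
  ... | true  = lin r (r - z + z) (≤-refl {0ℚ}) (solve (z ∷ []) ring)
  ... | false = lin r (0ℚ + z) (≤ᵇ-false {z} {r} eq) (solve (z ∷ []) ring)

  gap-cases : ∀ z → gap z + z ≤ r ⊎ gap z ≤ 0ℚ
  gap-cases z with z ≤ᵇ r
  ... | true  = inj₁ (lin (r - z + z) r (≤-refl {0ℚ}) (solve (z ∷ []) ring))
  ... | false = inj₂ ≤-refl

  gap-far : ∀ {z} → r ≤ z → gap z ≤ 0ℚ
  gap-far {z} r≤z with gap-cases z
  ... | inj₁ g+z≤r = cancel (gap z) g+z≤r
    where
    cancel : ∀ g → g + z ≤ r → g ≤ 0ℚ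
    cancel g h = lin g 0ℚ (+-mono-≤ h r≤z) (solve (g ∷ z ∷ []) ring)
  ... | inj₂ g≤0 = g≤0

  -- Profit (budget minus charge) of the edge uv when the ball around w is carved out, with z = z u v,
  -- p = z w u and q = z w v; b tells whether v lies in the ball, y and x are the gaps of uv and wv.
  -- u may lie in the core (p ≤ r), the shell (r ≤ p ≤ 2r), the rim (2r ≤ p ≤ 3r) or beyond;
  -- on the shell and the rim, the edge may lose y but then gains x.
  module _ {z p q : ℚ} (0≤z : 0ℚ ≤ z) (z≤1 : z ≤ 1ℚ)
           (z≤p+q : z ≤ p + q) (p≤q+z : p ≤ q + z) (q≤p+z : q ≤ p + z) where

    -- Separating a positive edge requires `q ≥ 2r`, so `z ≥ q - p ≥ r`; keeping a negative one
    -- gives `z ≤ p + q ≤ 3r`, so `1 - z ≥ 2r`.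
    core : p ≤ r → ∀ s b → (b ≡ true → q ≤ r + r) → (b ≡ false → r + r ≤ q) →
           pay s b ≤ lp s z
    core p≤r true  true  _ _ = 0≤z
    core p≤r true  false _ far =
      lin r z (+-mono-≤ q≤p+z (+-mono-≤ p≤r (far refl))) (solve (z ∷ p ∷ q ∷ []) ring)
    core p≤r false true near _ =
      lin r (1ℚ - z) (+-mono-≤ z≤p+q (+-mono-≤ p≤r (+-mono-≤ (near refl) 0≤r)))
        (solve (z ∷ p ∷ q ∷ []) ring)
    core p≤r false false _ _ = lin 0ℚ (1ℚ - z) z≤1 (solve (z ∷ []) ring)

    -- The distance `z ≥ p - q ≥ r` alone pays for a separated positive edge.
    beyond : r + r + r ≤ p → q ≤ r + r → ∀ s → pay s false ≤ lp s z
    beyond 3r≤p q≤2r true  =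
      lin r z (+-mono-≤ p≤q+z (+-mono-≤ 3r≤p q≤2r)) (solve (z ∷ p ∷ q ∷ []) ring)
    beyond 3r≤p q≤2r false = lin 0ℚ (1ℚ - z) z≤1 (solve (z ∷ []) ring)

    module _ {y x : ℚ} (0≤y : 0ℚ ≤ y) (r≤y+z : r ≤ y + z) where

      -- A separated positive edge is paid by `r ≤ y + z`; a kept one affords a positive `x`,
      -- because `x ≤ r - q ≤ p - q ≤ z`.
      shell : r ≤ p → p ≤ r + r →
              ∀ s b → (b ≡ true → q ≤ r + r) → (b ≡ false → r + r ≤ q) →
              x + q ≤ r ⊎ x ≤ 0ℚ → pay s b + x ≤ lp s z + y
      shell r≤p p≤2r true true _ _ (inj₁ x+q≤r) =
        lin (0ℚ + x) (z + y) (+-mono-≤ x+q≤r (+-mono-≤ r≤p (+-mono-≤ p≤q+z 0≤y)))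
          (solve (x ∷ y ∷ z ∷ p ∷ q ∷ []) ring)
      shell r≤p p≤2r true true _ _ (inj₂ x≤0) =
        lin (0ℚ + x) (z + y) (+-mono-≤ x≤0 (+-mono-≤ 0≤z 0≤y)) (solve (x ∷ y ∷ z ∷ []) ring)
      shell r≤p p≤2r true false _ far (inj₁ x+q≤r) =
        lin (r + x) (z + y) (+-mono-≤ x+q≤r (+-mono-≤ (far refl) (+-mono-≤ r≤y+z 0≤r)))
          (solve (x ∷ y ∷ z ∷ q ∷ []) ring)
      shell r≤p p≤2r true false _ far (inj₂ x≤0) =
        lin (r + x) (z + y) (+-mono-≤ x≤0 r≤y+z) (solve (x ∷ y ∷ z ∷ []) ring)
      shell r≤p p≤2r false true near _ (inj₁ x+q≤r) =
        lin (r + x) (1ℚ - z + y) (+-mono-≤ x+q≤r (+-mono-≤ z≤p+q (+-mono-≤ p≤2r (+-mono-≤ 0≤y 0≤r))))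
          (solve (x ∷ y ∷ z ∷ p ∷ q ∷ []) ring)
      -- Here `z ≤ p + q ≤ 4r`, and `1 - 4r = r` because `r = 1/5`.
      shell r≤p p≤2r false true near _ (inj₂ x≤0) =
        lin (r + x) (1ℚ - z + y) (+-mono-≤ x≤0 (+-mono-≤ z≤p+q (+-mono-≤ p≤2r (+-mono-≤ (near refl) 0≤y))))
          (solve (x ∷ y ∷ z ∷ p ∷ q ∷ []) ring)
      shell r≤p p≤2r false false _ far (inj₁ x+q≤r) =
        lin (0ℚ + x) (1ℚ - z + y) (+-mono-≤ x+q≤r (+-mono-≤ (far refl) (+-mono-≤ z≤1 (+-mono-≤ 0≤y 0≤r))))
          (solve (x ∷ y ∷ z ∷ q ∷ []) ring)
      shell r≤p p≤2r false false _ far (inj₂ x≤0) =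
        lin (0ℚ + x) (1ℚ - z + y) (+-mono-≤ x≤0 (+-mono-≤ z≤1 0≤y)) (solve (x ∷ y ∷ z ∷ []) ring)

      -- If `x + q ≤ r`, a positive edge has `z ≥ p - q ≥ 2r - q ≥ r + x`, and a negative one has
      -- `z ≤ 3r + q ≤ 4r - x`, hence `1 - z ≥ r + x`.
      rim : r + r ≤ p → p ≤ r + r + r → ∀ s →
                 x + q ≤ r ⊎ x ≤ 0ℚ → pay s false + x ≤ lp s z + y
      rim 2r≤p p≤3r true (inj₁ x+q≤r) =
        lin (r + x) (z + y) (+-mono-≤ x+q≤r (+-mono-≤ 2r≤p (+-mono-≤ p≤q+z 0≤y)))
          (solve (x ∷ y ∷ z ∷ p ∷ q ∷ []) ring)
      rim 2r≤p p≤3r true (inj₂ x≤0) =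
        lin (r + x) (z + y) (+-mono-≤ x≤0 r≤y+z) (solve (x ∷ y ∷ z ∷ []) ring)
      rim 2r≤p p≤3r false (inj₁ x+q≤r) =
        lin (0ℚ + x) (1ℚ - z + y) (+-mono-≤ x+q≤r (+-mono-≤ z≤p+q (+-mono-≤ p≤3r (+-mono-≤ 0≤y 0≤r))))
          (solve (x ∷ y ∷ z ∷ p ∷ q ∷ []) ring)
      rim 2r≤p p≤3r false (inj₂ x≤0) =
        lin (0ℚ + x) (1ℚ - z + y) (+-mono-≤ x≤0 (+-mono-≤ z≤1 0≤y)) (solve (x ∷ y ∷ z ∷ []) ring)

  lookup-─ : ∀ {n} (p q : Subset n) v → lookup (p ─ q) v ≡ not (lookup q v) ∧ lookup p v
  lookup-─ p q v with lookup q v | lookup p v | lookup-zipWith _ v p q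
  ... | true  | _ | eq = eq
  ... | false | _ | eq = eq

  mask-∧ : ∀ b t x → mask (b ∧ t) x ≡ mask t (mask b x)
  mask-∧ true  t     x = refl
  mask-∧ false true  x = refl
  mask-∧ false false x = refl

  -- A whole run, followed at one vertex.

  module PivotRounding {n : ℕ} (s : Fin n → Fin n → Bool) (z : Fin n → Fin n → ℚ)
           (0≤z : ∀ u v → 0ℚ ≤ z u v) (z≤1 : ∀ u v → z u v ≤ 1ℚ)
           (z-sym : ∀ u v → z u v ≡ z v u)
           (triangle : ∀ u v w → z u w ≤ z u v + z v w) where

    paid : Subset n → List (Subset n) → Fin n → Fin n → ℚ
    paid V Cs u v = mask (lookup V v) (pay (s u v) (clustersSC Cs u v))

    budget : Subset n → Fin n → Fin n → ℚ
    budget V u v = mask (lookup V v) (lp (s u v) (z u v))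

    margin : Subset n → Fin n → Fin n → ℚ
    margin V u v = mask (lookup V v) (gap (z u v))

    ball : Fin n → Fin n → Bool
    ball w v = z w v ≤ᵇ r + r

    lookup-cluster : ∀ V w v → lookup (Ball z w (r + r) ∩ V) v ≡ ball w v ∧ lookup V v
    lookup-cluster V w v = trans (lookup-zipWith _∧_ v (Ball z w (r + r)) V)
      (cong (_∧ lookup V v) (lookup∘tabulate (ball w) v))

    lookup-remaining : ∀ V w v → lookup (V ─ (Ball z w (r + r) ∩ V)) v ≡ not (ball w v) ∧ lookup V v
    lookup-remaining V w v = trans (lookup-─ V _ v) (trans (cong (λ b → not b ∧ lookup V v) (lookup-cluster V w v))
       (absorb (ball w v) (lookup V v)))
      where
      absorb : ∀ b t → not (b ∧ t) ∧ t ≡ not b ∧ t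
      absorb true  true  = refl
      absorb true  false = refl
      absorb false true  = refl
      absorb false false = refl

    score≡ : ∀ V u → score z V u ≡ sumℚ (margin V u)
    score≡ V u = sumℚ-cong λ v →
      trans (cong (λ b → mask b (r - z u v))
               (trans (lookup-zipWith _∧_ v (Ball z u r) V)
                      (cong (_∧ lookup V v) (lookup∘tabulate (λ v → z u v ≤ᵇ r) v))))
            (mask-∧ (z u v ≤ᵇ r) (lookup V v) _)

    -- All clusters of a run lie inside its initial set, so the later clusters never join a removed
    -- vertex to anything.
    clustersSC-outside : ∀ {V Cs} → KMZRun z V Cs → ∀ u v → lookup V u ≡ false ⊎ lookup V v ≡ false →
             clustersSC Cs u v ≡ false
    clustersSC-outside (done _) u v _ = refl
    clustersSC-outside {V} (step w _ _ run) u v out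
      rewrite lookup-cluster V w u | lookup-cluster V w v =
      cong₂ _∨_ (both out) (clustersSC-outside run u v (Sum.map (leave u) (leave v) out))
      where
      leave : ∀ x → lookup V x ≡ false → lookup (V ─ (Ball z w (r + r) ∩ V)) x ≡ false
      leave x eq = trans (lookup-remaining V w x) (trans (cong (not (ball w x) ∧_) eq) (∧-zeroʳ _))
      both : lookup V u ≡ false ⊎ lookup V v ≡ false →
             (ball w u ∧ lookup V u) ∧ (ball w v ∧ lookup V v) ≡ false
      both (inj₁ eq) rewrite eq | ∧-zeroʳ (ball w u) = refl
      both (inj₂ eq) rewrite eq | ∧-zeroʳ (ball w v) = ∧-zeroʳ _

    tri₁ : ∀ w u v → z u v ≤ z w u + z w v
    tri₁ w u v = subst (λ a → z u v ≤ a + z w v) (z-sym u w) (triangle u w v)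

    tri₂ : ∀ w u v → z w u ≤ z w v + z u v
    tri₂ w u v = subst (λ a → z w u ≤ z w v + a) (z-sym v u) (triangle w v u)

    near : ∀ w v → ball w v ≡ true → z w v ≤ r + r
    near w v = ≤ᵇ-true {z w v} {r + r}

    far : ∀ w v → ball w v ≡ false → r + r ≤ z w v
    far w v = ≤ᵇ-false {z w v} {r + r}

    mask-mono : ∀ t {p q} → p ≤ q → mask t p ≤ mask t q
    mask-mono true  h = h
    mask-mono false h = ≤-refl

    mask-mono₂ : ∀ t {a x b y} → a + x ≤ b + y → mask t a + mask t x ≤ mask t b + mask t y
    mask-mono₂ true  h = h
    mask-mono₂ false h = ≤-refl

    -- `X` and `Y` are auxiliary totals that make an edgewise comparison hold: the scores of `w` and
    -- `u`, ordered by the maximality of `w`, or the budget and payment of the remaining run,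
    -- ordered by induction.
    compensated : ∀ {F X G Y} → F + X ≤ G + Y → Y ≤ X → F ≤ G
    compensated {F} {X} {G} {Y} h k = lin F G (+-mono-≤ h k) (solve (F ∷ X ∷ G ∷ Y ∷ []) ring)

    r≤2r : r ≤ r + r
    r≤2r = ≤ᵇ⇒≤ _

    module _ {V : Subset n} {Cs : List (Subset n)} (w u : Fin n) (u∈V : lookup V u ≡ true)
             (best : sumℚ (margin V u) ≤ sumℚ (margin V w)) where

      V' : Subset n
      V' = V ─ (Ball z w (r + r) ∩ V)

      C : Subset n
      C = Ball z w (r + r) ∩ V

      -- All edges at `u` are settled at once, so no induction hypothesis is involved. In the core
      -- each edge pays for itself; in the shell the comparison is edgewise only after the scores
      -- are added.
      caught : KMZRun z V' Cs → ball w u ≡ true →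
               sumℚ (paid V (C ∷ Cs) u) ≤ sumℚ (budget V u)
      caught run u∈B = bound
        where
        sc≡ : ∀ v → mask (lookup V v) (pay (s u v) (clustersSC (C ∷ Cs) u v))
                  ≡ mask (lookup V v) (pay (s u v) (ball w v))
        sc≡ v rewrite lookup-cluster V w u | lookup-cluster V w v | u∈B | u∈V
          | clustersSC-outside run u v (inj₁ (trans (lookup-remaining V w u) (cong (λ b → not b ∧ lookup V u) u∈B)))
          with lookup V v
        ... | true  = cong (pay (s u v)) (trans (∨-identityʳ _) (∧-identityʳ _))
        ... | false = refl
        bound : sumℚ (paid V (C ∷ Cs) u) ≤ sumℚ (budget V u)
        bound with ≤-total (z w u) r
        ... | inj₁ p≤r = sumℚ-mono λ v → subst (_≤ budget V u v) (sym (sc≡ v))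
          (mask-mono (lookup V v) (core (0≤z u v) (z≤1 u v) (tri₁ w u v) (tri₂ w u v) (triangle w u v)
             p≤r (s u v) (ball w v) (near w v) (far w v)))
        ... | inj₂ r≤p = compensated
          (subst₂ _≤_ (sumℚ-distrib-+ (paid V (C ∷ Cs) u) (margin V w)) (sumℚ-distrib-+ (budget V u) (margin V u))
            (sumℚ-mono λ v → subst (λ a → a + margin V w v ≤ budget V u v + margin V u v) (sym (sc≡ v))
               (mask-mono₂ (lookup V v)
                 (shell (0≤z u v) (z≤1 u v) (tri₁ w u v) (tri₂ w u v) (triangle w u v)
                   (gap-nonneg (z u v)) (r≤gap+ (z u v)) r≤p (near w u u∈B)
                   (s u v) (ball w v) (near w v) (far w v) (gap-cases (z w v))))))
          best

      -- The edges from `u` to the carved cluster are settled by separation, and the others are left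
      -- to the remaining run.
      missed : KMZRun z V' Cs → ball w u ≡ false → sumℚ (paid V' Cs u) ≤ sumℚ (budget V' u) →
               sumℚ (paid V (C ∷ Cs) u) ≤ sumℚ (budget V u)
      missed run u∉B ih = bound
        where
        sc≡ : ∀ v → clustersSC (C ∷ Cs) u v ≡ clustersSC Cs u v
        sc≡ v rewrite lookup-cluster V w u | u∉B = refl

        removed : ∀ v → ball w v ≡ true → clustersSC Cs u v ≡ false
        removed v v∈B = clustersSC-outside run u v
          (inj₂ (trans (lookup-remaining V w v) (cong (λ b → not b ∧ lookup V v) v∈B)))

        -- The budget of the remaining run stands on the left and its payment on the right, so that
        -- deferred edges cancel without subtraction. Keeping `x` and `y` arbitrary covers both the
        -- gaps used up to `3r` and the zeros used beyond.
        pointwise : ∀ v x y → (ball w v ≡ false → x ≤ y) →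
          (ball w v ≡ true → pay (s u v) false + x ≤ lp (s u v) (z u v) + y) →
          (paid V (C ∷ Cs) u v + mask (lookup V v) x) + budget V' u v
            ≤ (budget V u v + mask (lookup V v) y) + paid V' Cs u v
        pointwise v x y out inn rewrite sc≡ v | lookup-remaining V w v with lookup V v | ball w v in eq
        ... | false | true = ≤-refl
        ... | false | false = ≤-refl
        ... | true | true rewrite removed v eq = +-mono-≤ (inn refl) (≤-refl {0ℚ})
        ... | true | false = swapped (pay (s u v) (clustersSC Cs u v)) (lp (s u v) (z u v)) (out refl)
          where
          swapped : ∀ a b → x ≤ y → a + x + b ≤ b + y + a
          swapped a b h = lin (a + x + b) (b + y + a) h (solve (a ∷ b ∷ x ∷ y ∷ []) ring)

        total : ∀ {x y : Fin n → ℚ} →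
          sumℚ y ≤ sumℚ x →
          (∀ v → (paid V (C ∷ Cs) u v + x v) + budget V' u v ≤ (budget V u v + y v) + paid V' Cs u v) →
          sumℚ (paid V (C ∷ Cs) u) ≤ sumℚ (budget V u)
        total {x} {y} Y≤X h = compensated
          (compensated {sumℚ (paid V (C ∷ Cs) u) + sumℚ x} {sumℚ (budget V' u)}
            (subst₂ _≤_ (sum₃ (paid V (C ∷ Cs) u) x (budget V' u)) (sum₃ (budget V u) y (paid V' Cs u))
              (sumℚ-mono h)) ih)
          Y≤X
          where
          sum₃ : ∀ (f g h : Fin n → ℚ) → sumℚ (λ v → (f v + g v) + h v) ≡ (sumℚ f + sumℚ g) + sumℚ h
          sum₃ f g h = trans (sumℚ-distrib-+ (λ v → f v + g v) h) (cong (_+ sumℚ h) (sumℚ-distrib-+ f g))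

        bound : sumℚ (paid V (C ∷ Cs) u) ≤ sumℚ (budget V u)
        bound with ≤-total (z w u) (r + r + r)
        ... | inj₁ p≤3r = total best λ v → pointwise v (gap (z w v)) (gap (z u v))
          -- A vertex outside the ball is at distance at least `2r ≥ r` from `w` and adds nothing to
          -- the score of `w`.
          (λ v∉B → ≤-trans (gap-far (≤-trans r≤2r (far w v v∉B))) (gap-nonneg (z u v)))
          (λ v∈B → rim (0≤z u v) (z≤1 u v) (tri₁ w u v) (tri₂ w u v) (triangle w u v)
             (gap-nonneg (z u v)) (r≤gap+ (z u v)) (far w u u∉B) p≤3r (s u v) (gap-cases (z w v)))
        ... | inj₂ 3r≤p = total ≤-refl λ v → pointwise v 0ℚ 0ℚ (λ _ → ≤-refl)
          (λ v∈B → +-mono-≤ (beyond (0≤z u v) (z≤1 u v) (tri₁ w u v) (tri₂ w u v) (triangle w u v)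
             3r≤p (near w v v∈B) (s u v)) (≤-refl {0ℚ}))

    -- Induction on the run. The bound is per vertex, so it serves the ℓ₁ and the ℓ∞ objective
    -- alike.
    rounding : ∀ {V Cs} → KMZRun z V Cs → ∀ u → lookup V u ≡ true →
               sumℚ (paid V Cs u) ≤ sumℚ (budget V u)
    rounding {V} (done empty) u u∈V with () ← empty (u , lookup⇒[]= u V u∈V)
    rounding {V} (step w _ argmax run) u u∈V with ball w u in eq
    ... | true  = caught w u u∈V best run eq
      where best = subst₂ _≤_ (score≡ V u) (score≡ V w) (argmax u (lookup⇒[]= u V u∈V))
    ... | false = missed w u u∈V best run eq (rounding run u
                    (trans (lookup-remaining V w u) (trans (cong (λ b → not b ∧ lookup V u) eq) u∈V)))
      where best = subst₂ _≤_ (score≡ V u) (score≡ V w) (argmax u (lookup⇒[]= u V u∈V))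

-- Double counting of disagreements.

module Counting where

  open import Data.Bool using (Bool; true; false; _∧_; _∨_; not; if_then_else_)
  open import Data.Fin as Fin using (Fin; zero; suc)
  open import Data.Fin.Subset using (Subset; ∣_∣; _∩_; _∪_)
  open import Data.Nat
  open import Data.Nat.Properties
  open import Data.Nat.Tactic.RingSolver using (solve-∀)
  open import Data.Vec using (lookup; []; _∷_)
  open import Data.Vec.Properties using (lookup-zipWith; lookup∘tabulate)
  open import Relation.Nullary using (yes; no; contradiction)
  open import Relation.Binary.PropositionalEquality
  open Rounding using (conflict)

  ⟦_⟧ : Bool → ℕ
  ⟦ b ⟧ = if b then 1 else 0

  sumℕ-mono : ∀ {n} {f g : Fin n → ℕ} → (∀ i → f i ≤ g i) → sumℕ f ≤ sumℕ g
  sumℕ-mono {zero}  h = z≤n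
  sumℕ-mono {suc n} h = +-mono-≤ (h zero) (sumℕ-mono (λ i → h (suc i)))

  sumℕ-cong : ∀ {n} {f g : Fin n → ℕ} → (∀ i → f i ≡ g i) → sumℕ f ≡ sumℕ g
  sumℕ-cong {zero}  h = refl
  sumℕ-cong {suc n} h = cong₂ _+_ (h zero) (sumℕ-cong (λ i → h (suc i)))

  sumℕ-distrib-+ : ∀ {n} (f g : Fin n → ℕ) → sumℕ (λ i → f i + g i) ≡ sumℕ f + sumℕ g
  sumℕ-distrib-+ {zero}  f g = refl
  sumℕ-distrib-+ {suc n} f g =
    trans (cong (f zero + g zero +_) (sumℕ-distrib-+ (λ i → f (suc i)) (λ i → g (suc i))))
          (interchange (f zero) (g zero) _ _)
    where
    interchange : ∀ a b c d → (a + b) + (c + d) ≡ (a + c) + (b + d)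
    interchange = solve-∀

  sumℕ-*ˡ : ∀ {n} a (f : Fin n → ℕ) → sumℕ (λ i → a * f i) ≡ a * sumℕ f
  sumℕ-*ˡ {zero}  a f = sym (*-zeroʳ a)
  sumℕ-*ˡ {suc n} a f =
    trans (cong (a * f zero +_) (sumℕ-*ˡ a (λ i → f (suc i)))) (sym (*-distribˡ-+ a (f zero) _))

  sumℕ-*ʳ : ∀ {n} (f : Fin n → ℕ) a → sumℕ (λ i → f i * a) ≡ sumℕ f * a
  sumℕ-*ʳ f a = trans (sumℕ-cong λ i → *-comm (f i) a) (trans (sumℕ-*ˡ a f) (*-comm a _))

  sumℕ-zero : ∀ n → sumℕ {n} (λ _ → 0) ≡ 0
  sumℕ-zero zero    = refl
  sumℕ-zero (suc n) = sumℕ-zero n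

  sumℕ-swap : ∀ {m n} (f : Fin m → Fin n → ℕ) →
              sumℕ (λ i → sumℕ (f i)) ≡ sumℕ (λ j → sumℕ (λ i → f i j))
  sumℕ-swap {zero}  {n} f = sym (sumℕ-zero n)
  sumℕ-swap {suc m} {n} f =
    trans (cong (sumℕ (f zero) +_) (sumℕ-swap (λ i → f (suc i))))
          (sym (sumℕ-distrib-+ (f zero) (λ j → sumℕ (λ i → f (suc i) j))))

  term≤sumℕ : ∀ {n} (f : Fin n → ℕ) i → f i ≤ sumℕ f
  term≤sumℕ f zero    = m≤m+n _ _
  term≤sumℕ f (suc i) = ≤-trans (term≤sumℕ (λ i → f (suc i)) i) (m≤n+m _ _)

  term≤maxℕ : ∀ {n} (f : Fin n → ℕ) i → f i ≤ maxℕ f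
  term≤maxℕ f zero    = m≤m⊔n _ _
  term≤maxℕ f (suc i) = ≤-trans (term≤maxℕ (λ i → f (suc i)) i) (m≤n⊔m _ _)

  maxℕ-lub : ∀ {n} (f : Fin n → ℕ) {m} → (∀ i → f i ≤ m) → maxℕ f ≤ m
  maxℕ-lub {zero}  f h = z≤n
  maxℕ-lub {suc n} f h = ⊔-lub (h zero) (maxℕ-lub (λ i → f (suc i)) (λ i → h (suc i)))

  ∣p∣≡sumℕ : ∀ {n} (p : Subset n) → ∣ p ∣ ≡ sumℕ (λ i → ⟦ lookup p i ⟧)
  ∣p∣≡sumℕ []          = refl
  ∣p∣≡sumℕ (true ∷ p)  = cong suc (∣p∣≡sumℕ p)
  ∣p∣≡sumℕ (false ∷ p) = ∣p∣≡sumℕ p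

  -- Positive neighbourhoods of equal size.

  module Regular {n : ℕ} (G : Instance n) (k : ℕ) (regular : ∀ u → ∣ N⁺ G u ∣ ≡ k) where

    s : Fin n → Fin n → Bool
    s = sign G

    common : Fin n → Fin n → ℕ
    common u v = sumℕ (λ w → ⟦ s u w ∧ s v w ⟧)

    excess : Fin n → Fin n → ℕ
    excess u v = sumℕ (λ w → ⟦ s u w ∧ not (s v w) ⟧)

    degree : ∀ u → sumℕ (λ v → ⟦ s u v ⟧) ≡ k
    degree u = trans (sumℕ-cong λ v → cong ⟦_⟧ (sym (lookup∘tabulate (s u) v)))
                     (trans (sym (∣p∣≡sumℕ (N⁺ G u))) (regular u))

    -- The self-loop counts towards the degree. A vertex must be given, since on the empty graph
    -- every `k` is a common degree, even 0.
    0<k : Fin n → 0 < k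
    0<k u = subst₂ _≤_ (cong ⟦_⟧ (selfLoop G u)) (degree u) (term≤sumℕ (λ v → ⟦ s u v ⟧) u)

    common+excess : ∀ u v → common u v + excess u v ≡ k
    common+excess u v = trans (sym (sumℕ-distrib-+ (λ w → ⟦ s u w ∧ s v w ⟧) _))
      (trans (sumℕ-cong λ w → split (s u w) (s v w)) (degree u))
      where
      split : ∀ a b → ⟦ a ∧ b ⟧ + ⟦ a ∧ not b ⟧ ≡ ⟦ a ⟧
      split true  true  = refl
      split true  false = refl
      split false _     = refl

    ∣∩∣ : ∀ u v → ∣ N⁺ G u ∩ N⁺ G v ∣ ≡ common u v
    ∣∩∣ u v = trans (∣p∣≡sumℕ (N⁺ G u ∩ N⁺ G v)) (sumℕ-cong λ w → cong ⟦_⟧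
      (trans (lookup-zipWith _∧_ w (N⁺ G u) (N⁺ G v))
             (cong₂ _∧_ (lookup∘tabulate (s u) w) (lookup∘tabulate (s v) w))))

    -- The union consists of `N⁺ G v`, of size `k` by regularity, and the part of `N⁺ G u` outside
    -- it.
    ∣∪∣ : ∀ u v → ∣ N⁺ G u ∪ N⁺ G v ∣ ≡ k + excess u v
    ∣∪∣ u v = begin
      ∣ N⁺ G u ∪ N⁺ G v ∣               ≡⟨ ∣p∣≡sumℕ (N⁺ G u ∪ N⁺ G v) ⟩
      sumℕ (λ w → ⟦ lookup (N⁺ G u ∪ N⁺ G v) w ⟧)
        ≡⟨ (sumℕ-cong λ w → trans (cong ⟦_⟧ (trans (lookup-zipWith _∨_ w (N⁺ G u) (N⁺ G v))
             (cong₂ _∨_ (lookup∘tabulate (s u) w) (lookup∘tabulate (s v) w)))) (split (s u w) (s v w))) ⟩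
      sumℕ (λ w → ⟦ s v w ⟧ + ⟦ s u w ∧ not (s v w) ⟧)
        ≡⟨ sumℕ-distrib-+ (λ w → ⟦ s v w ⟧) _ ⟩
      sumℕ (λ w → ⟦ s v w ⟧) + excess u v ≡⟨ cong (_+ excess u v) (degree v) ⟩
      k + excess u v ∎
      where
      open ≡-Reasoning
      split : ∀ a b → ⟦ a ∨ b ⟧ ≡ ⟦ b ⟧ + ⟦ a ∧ not b ⟧
      split true  true  = refl
      split true  false = refl
      split false true  = refl
      split false false = refl

    -- A vertex of `N⁺ G u` outside `N⁺ G w` is counted in `excess u v` if it misses `N⁺ G v`, and
    -- in `excess v w` otherwise.
    excess-triangle : ∀ u v w → excess u w ≤ excess u v + excess v w
    excess-triangle u v w = ≤-trans (sumℕ-mono λ x → split (s u x) (s v x) (s w x))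
      (≤-reflexive (sumℕ-distrib-+ (λ x → ⟦ s u x ∧ not (s v x) ⟧) _))
      where
      split : ∀ a b c → ⟦ a ∧ not c ⟧ ≤ ⟦ a ∧ not b ⟧ + ⟦ b ∧ not c ⟧
      split true  true  c = ≤-refl
      split true  false true  = z≤n
      split true  false false = ≤-refl
      split false b c = z≤n

    -- Charging the fractional cost to an arbitrary clustering.

    module Clustering (lab : Fin n → Fin n) where

      c : Fin n → Fin n → Bool
      c = labelSC lab

      err : Fin n → Fin n → ℕ
      err u v = ⟦ conflict (s u v) (c u v) ⟧

      y : Fin n → ℕ
      y = disagree G c

      neighbourCost : Fin n → ℕ
      neighbourCost u = sumℕ (λ v → ⟦ s u v ⟧ * y v)

      -- Dominates k times the fractional cost of the edge uv.
      charge : Fin n → Fin n → ℕ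
      charge u v = if s u v then (if c u v then 2 * excess u v else k)
                            else (if c u v then k else common u v)

      c-agree : ∀ u v w → c u v ≡ true → c u w ≡ c v w
      c-agree u v w _ with lab u Fin.≟ lab v
      c-agree u v w _ | yes eq rewrite eq = refl
      c-agree u v w () | no _

      c-sym : ∀ u v → c u v ≡ c v u
      c-sym u v with lab u Fin.≟ lab v | lab v Fin.≟ lab u
      ... | yes _ | yes _ = refl
      ... | no _  | no _  = refl
      ... | yes p | no ¬q = contradiction (sym p) ¬q
      ... | no ¬p | yes q = contradiction (sym q) ¬p

      err-sym : ∀ u v → err u v ≡ err v u
      err-sym u v = cong₂ (λ a b → ⟦ conflict a b ⟧) (symmetric G u v) (c-sym u v)

      -- `w` shares the cluster of both `u` and `v` or of neither, so of its two edges, which have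
      -- opposite signs, one is in disagreement.
      excess-term : ∀ u v w → c u v ≡ true → ⟦ s u w ∧ not (s v w) ⟧ ≤ err u w + err v w
      excess-term u v w uv rewrite c-agree u v w uv with s u w | s v w | c v w
      ... | true  | true  | _     = z≤n
      ... | true  | false | true  = s≤s z≤n
      ... | true  | false | false = s≤s z≤n
      ... | false | _     | _     = z≤n

      -- `w` cannot share a cluster with both ends, so one of its two positive edges is cut. The
      -- sign factors, equal to 1 for a common neighbour, keep the later sum over all `v` under
      -- control of the degree.
      common-term : ∀ u v w → c u v ≡ false →
                    ⟦ s u w ∧ s v w ⟧ ≤ err u w * ⟦ s v w ⟧ + ⟦ s u w ⟧ * err v w
      common-term u v w uv with s u w | s v w | c u w in uw | c v w in vw
      ... | true  | true  | true  | true
        with () ← trans (sym uv) (trans (c-sym u v) (trans (c-agree v w u vw) (trans (c-sym w u) uw)))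
      ... | true  | true  | true  | false = s≤s z≤n
      ... | true  | true  | false | _     = s≤s z≤n
      ... | true  | false | _     | _     = z≤n
      ... | false | _     | _     | _     = z≤n

      -- The three lines cover disagreeing edges, positive edges inside a cluster and negative edges
      -- between clusters. All three are added for every pair, so that the total needs no case
      -- distinction.
      bound : Fin n → Fin n → ℕ
      bound u v = k * err u v
                + 2 * (⟦ s u v ⟧ * y u + ⟦ s u v ⟧ * y v)
                + (sumℕ (λ w → err u w * ⟦ s v w ⟧) + sumℕ (λ w → ⟦ s u w ⟧ * err v w))

      charge≤bound : ∀ u v → charge u v ≤ bound u v
      charge≤bound u v with s u v | c u v in uv
      ... | true | true = ≤-trans (*-monoʳ-≤ 2 le) (≤-trans (m≤n+m _ (k * 0)) (m≤m+n _ _))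
        where
        le : excess u v ≤ 1 * y u + 1 * y v
        le = ≤-trans (sumℕ-mono λ w → excess-term u v w uv)
          (≤-reflexive (trans (sumℕ-distrib-+ (err u) (err v))
            (sym (cong₂ _+_ (*-identityˡ (y u)) (*-identityˡ (y v))))))
      ... | true | false = ≤-trans (≤-reflexive (sym (*-identityʳ k))) (≤-trans (m≤m+n _ _) (m≤m+n _ _))
      ... | false | true = ≤-trans (≤-reflexive (sym (*-identityʳ k))) (≤-trans (m≤m+n _ _) (m≤m+n _ _))
      ... | false | false = ≤-trans le (m≤n+m _ (k * 0 + 0))
        where
        le : common u v ≤ sumℕ (λ w → err u w * ⟦ s v w ⟧) + sumℕ (λ w → ⟦ s u w ⟧ * err v w)
        le = ≤-trans (sumℕ-mono λ w → common-term u v w uv)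
          (≤-reflexive (sumℕ-distrib-+ (λ w → err u w * ⟦ s v w ⟧) _))

      sum-bound : ∀ u → sumℕ (bound u) ≡ 4 * (k * y u) + 3 * neighbourCost u
      sum-bound u = begin
        sumℕ (bound u)
          ≡⟨ sumℕ-distrib-+ (λ v → k * err u v + 2 * (⟦ s u v ⟧ * y u + ⟦ s u v ⟧ * y v)) _ ⟩
        sumℕ (λ v → k * err u v + 2 * (⟦ s u v ⟧ * y u + ⟦ s u v ⟧ * y v))
          + sumℕ (λ v → sumℕ (λ w → err u w * ⟦ s v w ⟧) + sumℕ (λ w → ⟦ s u w ⟧ * err v w))
          ≡⟨ cong₂ _+_
               (trans (sumℕ-distrib-+ (λ v → k * err u v) _) (cong₂ _+_ (sumℕ-*ˡ k (err u))
                 (trans (sumℕ-*ˡ 2 (λ v → ⟦ s u v ⟧ * y u + ⟦ s u v ⟧ * y v)) (cong (2 *_)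
                   (trans (sumℕ-distrib-+ (λ v → ⟦ s u v ⟧ * y u) _)
                   (cong (_+ neighbourCost u) (trans (sumℕ-*ʳ (λ v → ⟦ s u v ⟧) (y u)) (cong (_* y u) (degree u)))))))))
               (trans (sumℕ-distrib-+ (λ v → sumℕ (λ w → err u w * ⟦ s v w ⟧)) _) (cong₂ _+_ third fourth)) ⟩
        -- The coefficients are `4 = 1 + 2 + 1` for `k * y u` and `3 = 2 + 1` for `neighbourCost u`.
        (k * y u + 2 * (k * y u + neighbourCost u)) + (y u * k + neighbourCost u)
          ≡⟨ collect k (y u) (neighbourCost u) ⟩
        4 * (k * y u) + 3 * neighbourCost u ∎
        where
        open ≡-Reasoning
        collect : ∀ k y t → (k * y + 2 * (k * y + t)) + (y * k + t) ≡ 4 * (k * y) + 3 * t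
        collect = solve-∀
        -- For fixed `w`, exactly `k` vertices `v` have a positive edge to `w`.
        third : sumℕ (λ v → sumℕ (λ w → err u w * ⟦ s v w ⟧)) ≡ y u * k
        third = trans (sumℕ-swap (λ v w → err u w * ⟦ s v w ⟧))
          (trans (sumℕ-cong λ w → trans (sumℕ-*ˡ (err u w) (λ v → ⟦ s v w ⟧))
            (cong (err u w *_) (trans (sumℕ-cong λ v → cong ⟦_⟧ (symmetric G v w)) (degree w))))
          (sumℕ-*ʳ (err u) k))
        -- For fixed `w`, the errors over all `v` add up to `y w`.
        fourth : sumℕ (λ v → sumℕ (λ w → ⟦ s u w ⟧ * err v w)) ≡ neighbourCost u
        fourth = trans (sumℕ-swap (λ v w → ⟦ s u w ⟧ * err v w))
          (sumℕ-cong λ w → trans (sumℕ-*ˡ ⟦ s u w ⟧ (λ v → err v w))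
            (cong (⟦ s u w ⟧ *_) (sumℕ-cong λ v → err-sym v w)))

      sum-charge : ∀ u → sumℕ (charge u) ≤ 4 * (k * y u) + 3 * neighbourCost u
      sum-charge u = ≤-trans (sumℕ-mono (charge≤bound u)) (≤-reflexive (sum-bound u))

      -- Each `y v` is counted once for every positive neighbour of `v`, hence `k` times.
      sum-neighbourCost : sumℕ neighbourCost ≡ k * ℓ₁ G c
      sum-neighbourCost = trans (sumℕ-swap (λ u v → ⟦ s u v ⟧ * y v))
        (trans (sumℕ-cong λ v → trans (sumℕ-*ʳ (λ u → ⟦ s u v ⟧) (y v))
           (cong (_* y v) (trans (sumℕ-cong λ u → cong ⟦_⟧ (symmetric G u v)) (degree v))))
        (sumℕ-*ˡ k y))

      neighbourCost≤ : ∀ u → neighbourCost u ≤ k * ℓ∞ G c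
      neighbourCost≤ u = ≤-trans (sumℕ-mono λ v → *-monoʳ-≤ ⟦ s u v ⟧ (term≤maxℕ y v))
        (≤-reflexive (trans (sumℕ-*ʳ (λ v → ⟦ s u v ⟧) (ℓ∞ G c)) (cong (_* ℓ∞ G c) (degree u))))

      collect : ∀ k t → 4 * (k * t) + 3 * (k * t) ≡ k * (7 * t)
      collect = solve-∀

      total-charge : sumℕ (λ u → sumℕ (charge u)) ≤ k * (7 * ℓ₁ G c)
      total-charge = ≤-trans (sumℕ-mono sum-charge) (≤-reflexive (begin
        sumℕ (λ u → 4 * (k * y u) + 3 * neighbourCost u)
          ≡⟨ sumℕ-distrib-+ (λ u → 4 * (k * y u)) _ ⟩
        sumℕ (λ u → 4 * (k * y u)) + sumℕ (λ u → 3 * neighbourCost u)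
          ≡⟨ cong₂ _+_ (trans (sumℕ-*ˡ 4 (λ u → k * y u)) (cong (4 *_) (sumℕ-*ˡ k y)))
                       (trans (sumℕ-*ˡ 3 neighbourCost) (cong (3 *_) sum-neighbourCost)) ⟩
        4 * (k * ℓ₁ G c) + 3 * (k * ℓ₁ G c) ≡⟨ collect k (ℓ₁ G c) ⟩
        k * (7 * ℓ₁ G c) ∎))
        where open ≡-Reasoning

      max-charge : ∀ u → sumℕ (charge u) ≤ k * (7 * ℓ∞ G c)
      max-charge u = ≤-trans (sum-charge u)
        (≤-trans (+-mono-≤ (*-monoʳ-≤ 4 (*-monoʳ-≤ k (term≤maxℕ y u))) (*-monoʳ-≤ 3 (neighbourCost≤ u)))
        (≤-reflexive (collect k (ℓ∞ G c))))

-- From counts to rational numbers.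

module CorrelationMetric where

  open import Data.Bool using (true; false; not; if_then_else_)
  open import Data.Fin using (Fin; zero; suc)
  open import Data.Fin.Subset using (Subset; ⊤; ∣_∣)
  open import Data.Fin.Subset.Properties using (∩-comm; ∪-comm)
  open import Data.Integer as ℤ using (+_)
  import Data.Integer.Properties as ℤₚ
  open import Data.List using (List; _∷_; [])
  open import Data.Nat as ℕ using (ℕ; zero; suc)
  import Data.Nat.Properties as ℕₚ
  import Data.Nat.Tactic.RingSolver as ℕ-RingSolver
  open import Data.Rational hiding (∣_∣)
  open import Data.Rational.Properties
  open import Data.Rational.Unnormalised as ℚᵘ using (mkℚᵘ)
  import Data.Rational.Unnormalised.Properties as ℚᵘₚ
  open import Data.Vec using (lookup)
  open import Data.Vec.Properties using (lookup-replicate; lookup∘tabulate)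
  open import Relation.Binary.PropositionalEquality
  open import Tactic.RingSolver using (solve)
  open Rounding
  open Counting

  -- `_/_` normalises, so identities between fractions are proved for unnormalised rationals and
  -- carried over by `fromℚᵘ`, of which `ι m` and `ratio a (suc b)` are values.
  fromℚᵘ-homo-+ : ∀ p q → fromℚᵘ (p ℚᵘ.+ q) ≡ fromℚᵘ p + fromℚᵘ q
  fromℚᵘ-homo-+ p q = toℚᵘ-injective (ℚᵘₚ.≃-trans (toℚᵘ-fromℚᵘ (p ℚᵘ.+ q))
    (ℚᵘₚ.≃-sym (ℚᵘₚ.≃-trans (toℚᵘ-homo-+ (fromℚᵘ p) (fromℚᵘ q))
      (ℚᵘₚ.+-cong (toℚᵘ-fromℚᵘ p) (toℚᵘ-fromℚᵘ q)))))

  fromℚᵘ-homo-* : ∀ p q → fromℚᵘ (p ℚᵘ.* q) ≡ fromℚᵘ p * fromℚᵘ q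
  fromℚᵘ-homo-* p q = toℚᵘ-injective (ℚᵘₚ.≃-trans (toℚᵘ-fromℚᵘ (p ℚᵘ.* q))
    (ℚᵘₚ.≃-sym (ℚᵘₚ.≃-trans (toℚᵘ-homo-* (fromℚᵘ p) (fromℚᵘ q))
      (ℚᵘₚ.*-cong (toℚᵘ-fromℚᵘ p) (toℚᵘ-fromℚᵘ q)))))

  fromℚᵘ-mono-≤ : ∀ {p q} → p ℚᵘ.≤ q → fromℚᵘ p ≤ fromℚᵘ q
  fromℚᵘ-mono-≤ {p} {q} h = toℚᵘ-cancel-≤ (ℚᵘₚ.≤-trans (ℚᵘₚ.≤-reflexive (toℚᵘ-fromℚᵘ p))
    (ℚᵘₚ.≤-trans h (ℚᵘₚ.≤-reflexive (ℚᵘₚ.≃-sym (toℚᵘ-fromℚᵘ q)))))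

  ι : ℕ → ℚ
  ι m = + m / 1

  ι-+ : ∀ m n → ι (m ℕ.+ n) ≡ ι m + ι n
  ι-+ m n = trans (fromℚᵘ-cong {mkℚᵘ (+ (m ℕ.+ n)) 0} {mkℚᵘ (+ m) 0 ℚᵘ.+ mkℚᵘ (+ n) 0}
      (ℚᵘ.*≡* (cong (ℤ._* + 1) (sym (cong₂ ℤ._+_ (ℤₚ.*-identityʳ (+ m)) (ℤₚ.*-identityʳ (+ n)))))))
    (fromℚᵘ-homo-+ (mkℚᵘ (+ m) 0) (mkℚᵘ (+ n) 0))

  ι-* : ∀ m n → ι (m ℕ.* n) ≡ ι m * ι n
  ι-* m n = trans (fromℚᵘ-cong {mkℚᵘ (+ (m ℕ.* n)) 0} {mkℚᵘ (+ m) 0 ℚᵘ.* mkℚᵘ (+ n) 0}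
      (ℚᵘ.*≡* (cong (ℤ._* + 1) (ℤₚ.pos-* m n))))
    (fromℚᵘ-homo-* (mkℚᵘ (+ m) 0) (mkℚᵘ (+ n) 0))

  ι-mono : ∀ {m n} → m ℕ.≤ n → ι m ≤ ι n
  ι-mono {m} {n} h = fromℚᵘ-mono-≤ {mkℚᵘ (+ m) 0} {mkℚᵘ (+ n) 0} (ℚᵘ.*≤* (ℤₚ.*-monoʳ-≤-nonNeg (+ 1) (ℤ.+≤+ h)))

  ι-cancel : ∀ {m n} → ι m ≤ ι n → m ℕ.≤ n
  ι-cancel {m} {n} h = ℕₚ.≮⇒≥ λ n<m → <-irrefl refl (<-≤-trans (ι-mono-< n<m) h)
    where
    ι-mono-< : n ℕ.< m → ι n < ι m
    ι-mono-< n<m = <-≤-trans (lt (ι n)) (≤-trans (≤-reflexive (sym (ι-+ 1 n))) (ι-mono {suc n} {m} n<m))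
      where
      lt : ∀ p → p < 1ℚ + p
      lt p = subst (_< 1ℚ + p) (+-identityˡ p) (+-monoˡ-< p (positive⁻¹ 1ℚ))

  0≤ι : ∀ m → 0ℚ ≤ ι m
  0≤ι m = ι-mono {0} {m} ℕ.z≤n

  ι-pos : ∀ {m} → 0 ℕ.< m → Positive (ι m)
  ι-pos {m} h = positive (<-≤-trans (positive⁻¹ 1ℚ) (ι-mono {1} {m} h))

  ι-sum : ∀ {n} (f : Fin n → ℕ) → ι (sumℕ f) ≡ sumℚ (λ i → ι (f i))
  ι-sum {zero}  f = refl
  ι-sum {suc n} f = trans (ι-+ (f zero) _) (cong (λ q → ι (f zero) + q) (ι-sum (λ i → f (suc i))))

  ratio-* : ∀ a {b} → 0 ℕ.< b → ratio a b * ι b ≡ ι a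
  ratio-* a {suc b} _ = trans (sym (fromℚᵘ-homo-* (mkℚᵘ (+ a) b) (mkℚᵘ (+ suc b) 0)))
    (fromℚᵘ-cong {mkℚᵘ (+ a) b ℚᵘ.* mkℚᵘ (+ suc b) 0} {mkℚᵘ (+ a) 0}
      (ℚᵘ.*≡* (trans (ℤₚ.*-identityʳ _) (cong (λ d → + a ℤ.* + suc d) (sym (ℕₚ.*-identityʳ b))))))

  *-nonneg : ∀ {p q} → 0ℚ ≤ p → 0ℚ ≤ q → 0ℚ ≤ p * q
  *-nonneg {p} {q} 0≤p 0≤q =
    nonNegative⁻¹ (p * q) {{nonNeg*nonNeg⇒nonNeg p {{nonNegative 0≤p}} q {{nonNegative 0≤q}}}}

  *-monoˡ : ∀ {a p q} → 0ℚ ≤ a → p ≤ q → a * p ≤ a * q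
  *-monoˡ {a} 0≤a = *-monoˡ-≤-nonNeg a {{nonNegative 0≤a}}

  -- The Jaccard similarity `ρ` and its complement.

  module Quotient {ρ I E K : ℚ} (K≡ : I + E ≡ K) (0≤I : 0ℚ ≤ I) (0≤E : 0ℚ ≤ E) (0<D : Positive (K + E))
           (ρD : ρ * (K + E) ≡ I) where

    private
      instance
        D⁺ : Positive (K + E)
        D⁺ = 0<D

    0≤ρ : 0ℚ ≤ ρ
    0≤ρ = *-cancelʳ-≤-pos (K + E) (≤-trans (≤-reflexive (*-zeroˡ (K + E)))
            (≤-trans 0≤I (≤-reflexive (sym ρD))))

    ρ≤1 : ρ ≤ 1ℚ
    ρ≤1 = *-cancelʳ-≤-pos (K + E) (≤-trans (≤-reflexive ρD)
      (lin I (1ℚ * (K + E)) (+-mono-≤ (≤-reflexive K≡) (+-mono-≤ 0≤E 0≤E))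
        (solve (I ∷ K ∷ E ∷ []) ring)))

    -- Enlarging the factor `K` to `K + E` turns the product into `I`.
    Kρ≤I : K * ρ ≤ I
    Kρ≤I = lin (K * ρ) I (+-mono-≤ (≤-reflexive ρD) (*-nonneg 0≤ρ 0≤E))
      (solve (ρ ∷ I ∷ K ∷ E ∷ []) ring)

    0≤1-ρ : 0ℚ ≤ 1ℚ - ρ
    0≤1-ρ = lin 0ℚ (1ℚ - ρ) ρ≤1 (solve (ρ ∷ []) ring)

    1-ρ≤1 : 1ℚ - ρ ≤ 1ℚ
    1-ρ≤1 = lin (1ℚ - ρ) 1ℚ 0≤ρ (solve (ρ ∷ []) ring)

    -- `K + E - I = 2E` because `K = I + E`. The product form of `d = 2e/(k + e)` spares the ring
    -- solver any division.
    [1-ρ]D : (1ℚ - ρ) * (K + E) ≡ E + E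
    [1-ρ]D = ≤-antisym
      (lin ((1ℚ - ρ) * (K + E)) (E + E) (+-mono-≤ (≤-reflexive (sym ρD)) (≤-reflexive (sym K≡)))
        (solve (ρ ∷ I ∷ K ∷ E ∷ []) ring))
      (lin (E + E) ((1ℚ - ρ) * (K + E)) (+-mono-≤ (≤-reflexive ρD) (≤-reflexive K≡))
        (solve (ρ ∷ I ∷ K ∷ E ∷ []) ring))

    K[1-ρ]≤2E : K * (1ℚ - ρ) ≤ E + E
    K[1-ρ]≤2E = lin (K * (1ℚ - ρ)) (E + E) (+-mono-≤ (≤-reflexive [1-ρ]D) (*-nonneg 0≤1-ρ 0≤E))
      (solve (ρ ∷ K ∷ E ∷ []) ring)

  -- Subadditivity of x ↦ 2x/(K + x), with the quotients given by their defining equations.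
  quotient-triangle : ∀ {K a b x p q t} → 0ℚ ≤ a → 0ℚ ≤ b → Positive (K + x) → x ≤ a + b →
    0ℚ ≤ p → 0ℚ ≤ q → p ≤ 1ℚ → q ≤ 1ℚ →
    p * (K + a) ≡ a + a → q * (K + b) ≡ b + b → t * (K + x) ≡ x + x → t ≤ p + q
  quotient-triangle {K} {a} {b} {x} {p} {q} {t} 0≤a 0≤b D⁺ x≤a+b 0≤p 0≤q p≤1 q≤1 p≡ q≡ t≡ =
    *-cancelʳ-≤-pos (K + x) {{D⁺}}
      -- The equations for `p` and `q` give `(p + q)(K + x) - 2x = (2 - p - q)(a + b - x) + pb +
      -- qa`, a sum of nonnegative terms.
      (lin (t * (K + x)) ((p + q) * (K + x))
        (+-mono-≤ (≤-reflexive t≡) (+-mono-≤ (≤-reflexive (sym p≡)) (+-mono-≤ (≤-reflexive (sym q≡))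
          (+-mono-≤ (*-monoˡ 0≤s x≤a+b) (+-mono-≤ (*-nonneg 0≤p 0≤b) (*-nonneg 0≤q 0≤a))))))
        (solve (K ∷ a ∷ b ∷ x ∷ p ∷ q ∷ t ∷ []) ring))
    where
    0≤s : 0ℚ ≤ (1ℚ - p) + (1ℚ - q)
    0≤s = lin 0ℚ ((1ℚ - p) + (1ℚ - q)) (+-mono-≤ p≤1 q≤1) (solve (p ∷ q ∷ []) ring)

  sumℚ-*ˡ : ∀ {n} a (f : Fin n → ℚ) → sumℚ (λ i → a * f i) ≡ a * sumℚ f
  sumℚ-*ˡ {zero}  a f = sym (*-zeroʳ a)
  sumℚ-*ˡ {suc n} a f =
    trans (cong (λ q → a * f zero + q) (sumℚ-*ˡ a (λ i → f (suc i)))) (sym (*-distribˡ-+ a (f zero) _))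

  -- Fractional cost and rounding on a regular instance.

  module Approximation {n : ℕ} (G : Instance n) (k : ℕ) (regular : ∀ u → ∣ N⁺ G u ∣ ≡ k) where

    open Regular G k regular

    z : Fin n → Fin n → ℚ
    z = corr G

    ρ : Fin n → Fin n → ℚ
    ρ u v = ratio (common u v) (k ℕ.+ excess u v)

    z≡ : ∀ u v → z u v ≡ 1ℚ - ρ u v
    z≡ u v = cong (λ q → 1ℚ - q) (cong₂ ratio (∣∩∣ u v) (∣∪∣ u v))

    0<D : ∀ u v → 0 ℕ.< k ℕ.+ excess u v
    0<D u v = ℕₚ.≤-trans (0<k u) (ℕₚ.m≤m+n k _)

    K≡ : ∀ u v → ι (common u v) + ι (excess u v) ≡ ι k
    K≡ u v = trans (sym (ι-+ (common u v) (excess u v))) (cong ι (common+excess u v))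

    D⁺ : ∀ u v → Positive (ι k + ι (excess u v))
    D⁺ u v = subst Positive (ι-+ k (excess u v)) (ι-pos {k ℕ.+ excess u v} (0<D u v))

    ρD : ∀ u v → ρ u v * (ι k + ι (excess u v)) ≡ ι (common u v)
    ρD u v = trans (cong (λ q → ρ u v * q) (sym (ι-+ k (excess u v)))) (ratio-* (common u v) (0<D u v))

    module Q (u v : Fin n) = Quotient {ρ u v} {ι (common u v)} {ι (excess u v)} {ι k}
      (K≡ u v) (0≤ι (common u v)) (0≤ι (excess u v)) (D⁺ u v) (ρD u v)

    0≤z : ∀ u v → 0ℚ ≤ z u v
    0≤z u v = subst (λ q → 0ℚ ≤ q) (sym (z≡ u v)) (Q.0≤1-ρ u v)

    z≤1 : ∀ u v → z u v ≤ 1ℚ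
    z≤1 u v = subst (_≤ 1ℚ) (sym (z≡ u v)) (Q.1-ρ≤1 u v)

    z-sym : ∀ u v → z u v ≡ z v u
    z-sym u v = cong (λ q → 1ℚ - q)
      (cong₂ ratio (cong ∣_∣ (∩-comm (N⁺ G u) (N⁺ G v))) (cong ∣_∣ (∪-comm (N⁺ G u) (N⁺ G v))))

    triangle : ∀ u v w → z u w ≤ z u v + z v w
    triangle u v w = subst₂ _≤_ (sym (z≡ u w)) (sym (cong₂ _+_ (z≡ u v) (z≡ v w)))
      (quotient-triangle {ι k} {ι (excess u v)} {ι (excess v w)} {ι (excess u w)}
        (0≤ι (excess u v)) (0≤ι (excess v w)) (D⁺ u w)
        (subst (ι (excess u w) ≤_) (ι-+ (excess u v) (excess v w))
          (ι-mono {excess u w} {excess u v ℕ.+ excess v w} (excess-triangle u v w)))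
        (Q.0≤1-ρ u v) (Q.0≤1-ρ v w) (Q.1-ρ≤1 u v) (Q.1-ρ≤1 v w)
        (Q.[1-ρ]D u v) (Q.[1-ρ]D v w) (Q.[1-ρ]D u w))

    cost : Fin n → ℚ
    cost u = sumℚ (λ v → lp (s u v) (z u v))

    fracCost≡ : fracCost G z ≡ sumℚ cost
    fracCost≡ = trans (sym (sumℚ-distrib-+ (λ u → sumℚ-over (N⁺ G u) (z u)) _))
      (sumℚ-cong λ u → trans (sym (sumℚ-distrib-+ (λ v → mask (lookup (N⁺ G u) v) (z u v)) _))
        (sumℚ-cong λ v → trans (cong₂ (λ a b → mask a (z u v) + mask b (1ℚ - z u v))
            (lookup∘tabulate (s u) v) (lookup∘tabulate (λ v → not (s u v)) v))
          (merge (s u v) (z u v))))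
      where
      merge : ∀ b x → mask b x + mask (not b) (1ℚ - x) ≡ lp b x
      merge true  x = +-identityʳ x
      merge false x = +-identityˡ (1ℚ - x)

    module _ (lab : Fin n → Fin n) where

      open Clustering lab

      -- A disagreeing edge costs at most 1; on the others the quotient bounds replace `k d` by `2e`
      -- and `k (1 - d)` by the number of common neighbours.
      k*lp≤charge : ∀ u v → ι k * lp (s u v) (z u v) ≤ ι (charge u v)
      k*lp≤charge u v rewrite z≡ u v with s u v | c u v
      ... | true  | true  = ≤-trans (Q.K[1-ρ]≤2E u v) (≤-reflexive (double (excess u v)))
        where
        double : ∀ m → ι m + ι m ≡ ι (2 ℕ.* m)
        double m = trans (sym (ι-+ m m)) (cong (λ a → ι (m ℕ.+ a)) (sym (ℕₚ.+-identityʳ m)))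
      ... | true  | false = ≤-trans (*-monoˡ (0≤ι k) (Q.1-ρ≤1 u v)) (≤-reflexive (*-identityʳ (ι k)))
      ... | false | true  = ≤-trans (*-monoˡ (0≤ι k) (lin (1ℚ - (1ℚ - ρ u v)) 1ℚ (Q.0≤1-ρ u v) (cancel (ρ u v))))
                                    (≤-reflexive (*-identityʳ (ι k)))
        where
        cancel : ∀ q → 1ℚ + 0ℚ ≡ 1ℚ - (1ℚ - q) + (1ℚ - q)
        cancel q = solve (q ∷ []) ring
      ... | false | false = ≤-trans (≤-reflexive (cong (λ q → ι k * q) (cancel (ρ u v)))) (Q.Kρ≤I u v)
        where
        cancel : ∀ q → 1ℚ - (1ℚ - q) ≡ q
        cancel q = solve (q ∷ []) ring

      k*cost≤charge : ∀ u → ι k * cost u ≤ ι (sumℕ (charge u))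
      k*cost≤charge u = subst₂ _≤_ (sumℚ-*ˡ (ι k) (λ v → lp (s u v) (z u v))) (sym (ι-sum (charge u)))
        (sumℚ-mono (k*lp≤charge u))

      k*fracCost≤ : ι k * fracCost G z ≤ ι (k ℕ.* (7 ℕ.* ℓ₁ G c))
      k*fracCost≤ = ≤-trans (subst₂ _≤_
          (trans (sumℚ-*ˡ (ι k) cost) (cong (λ q → ι k * q) (sym fracCost≡)))
          (sym (ι-sum (λ u → sumℕ (charge u))))
          (sumℚ-mono k*cost≤charge))
        (ι-mono {sumℕ (λ u → sumℕ (charge u))} {k ℕ.* (7 ℕ.* ℓ₁ G c)} total-charge)

      module _ {Cs : List (Subset n)} (run : KMZRun z ⊤ Cs) where

        open PivotRounding s z 0≤z z≤1 z-sym triangle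

        rounded : Fin n → ℕ
        rounded = disagree G (clustersSC Cs)

        paid≡ : ∀ u → sumℚ (paid ⊤ Cs u) ≡ r * ι (rounded u)
        paid≡ u = trans (sumℚ-cong λ v → trans (cong (λ b → mask b (pay (s u v) (clustersSC Cs u v)))
              (lookup-replicate v true)) (unit (conflict (s u v) (clustersSC Cs u v))))
            (trans (sumℚ-*ˡ r (λ v → ι ⟦ conflict (s u v) (clustersSC Cs u v) ⟧))
              (cong (λ q → r * q) (sym (ι-sum (λ v → ⟦ conflict (s u v) (clustersSC Cs u v) ⟧)))))
          where
          unit : ∀ b → (if b then r else 0ℚ) ≡ r * ι ⟦ b ⟧
          unit true  = refl
          unit false = refl

        budget≡ : ∀ u → sumℚ (budget ⊤ u) ≡ cost u
        budget≡ u = sumℚ-cong λ v → cong (λ b → mask b (lp (s u v) (z u v))) (lookup-replicate v true)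

        k*rounded≤charge : ∀ u → k ℕ.* rounded u ℕ.≤ 5 ℕ.* sumℕ (charge u)
        k*rounded≤charge u = ι-cancel {k ℕ.* rounded u} {5 ℕ.* sumℕ (charge u)}
          (subst₂ _≤_ (trans (rescale (ι k) (ι (rounded u))) (sym (ι-* k (rounded u))))
                      (sym (ι-* 5 (sumℕ (charge u))))
            (*-monoˡ (0≤ι 5) (≤-trans (*-monoˡ (0≤ι k) step≤) (k*cost≤charge u))))
          where
          -- Rests on `5 * r = 1`.
          rescale : ∀ a b → ι 5 * (a * (r * b)) ≡ a * b
          rescale a b = solve (a ∷ b ∷ []) ring
          step≤ : r * ι (rounded u) ≤ cost u
          step≤ = subst₂ _≤_ (paid≡ u) (budget≡ u) (rounding run u (lookup-replicate u true))

    collect : ∀ k t → 5 ℕ.* (k ℕ.* (7 ℕ.* t)) ≡ k ℕ.* (35 ℕ.* t)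
    collect = ℕ-RingSolver.solve-∀

    -- `35 = 5 * 7`: the rounding loses a factor 5 and the fractional cost a factor 7. The vertex
    -- ensures `k > 0`.
    cancel-k : Fin n → ∀ {a b} → k ℕ.* a ℕ.≤ 5 ℕ.* (k ℕ.* (7 ℕ.* b)) → a ℕ.≤ 35 ℕ.* b
    cancel-k u {a} {b} h = ℕₚ.*-cancelˡ-≤ k {{ℕ.>-nonZero (0<k u)}}
      (ℕₚ.≤-trans h (ℕₚ.≤-reflexive (collect k b)))

    rounded-ℓ∞ : ∀ {Cs} → KMZRun z ⊤ Cs → ∀ lab → ℓ∞ G (clustersSC Cs) ℕ.≤ 35 ℕ.* ℓ∞ G (labelSC lab)
    rounded-ℓ∞ run lab = maxℕ-lub (rounded lab run) λ u → cancel-k u {rounded lab run u} {ℓ∞ G (labelSC lab)}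
      (ℕₚ.≤-trans (k*rounded≤charge lab run u) (ℕₚ.*-monoʳ-≤ 5 (Clustering.max-charge lab u)))

  fracCost-bound : ∀ {n} (G : Instance n) k (regular : ∀ u → ∣ N⁺ G u ∣ ≡ k) lab →
                   fracCost G (corr G) ≤ ι 35 * ι (ℓ₁ G (labelSC lab))
  -- Without vertices `k` may be 0 and cannot be cancelled, but both sides compute to 0.
  fracCost-bound {zero}  G k regular lab = ≤-refl
  fracCost-bound {suc n} G k regular lab = *-cancelˡ-≤-pos (ι k) {{ι-pos {k} (0<k zero)}}
    (≤-trans (k*fracCost≤ lab)
      -- The factor 7 is relaxed to `35 = 7 + 28`, so that one constant serves all three bounds.
      (≤-trans (ι-mono {k ℕ.* (7 ℕ.* y)} {k ℕ.* (35 ℕ.* y)} (ℕₚ.*-monoʳ-≤ k (ℕₚ.*-monoˡ-≤ y (ℕₚ.m≤m+n 7 28))))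
        (≤-reflexive (trans (ι-* k (35 ℕ.* y)) (cong (λ q → ι k * q) (ι-* 35 y))))))
    where
    open Regular G k regular
    open Approximation G k regular
    y : ℕ
    y = ℓ₁ G (labelSC lab)

  rounded-ℓ₁ : ∀ {n} (G : Instance n) k (regular : ∀ u → ∣ N⁺ G u ∣ ≡ k) {Cs} → KMZRun (corr G) ⊤ Cs →
               ∀ lab → ℓ₁ G (clustersSC Cs) ℕ.≤ 35 ℕ.* ℓ₁ G (labelSC lab)
  rounded-ℓ₁ {zero}  G k regular run lab = ℕ.z≤n
  rounded-ℓ₁ {suc n} G k regular {Cs} run lab = cancel-k zero {ℓ₁ G (clustersSC Cs)} {ℓ₁ G (labelSC lab)}
    (ℕₚ.≤-trans (ℕₚ.≤-reflexive (sym (sumℕ-*ˡ k (rounded lab run))))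
    (ℕₚ.≤-trans (sumℕ-mono (k*rounded≤charge lab run))
    (ℕₚ.≤-trans (ℕₚ.≤-reflexive (sumℕ-*ˡ 5 (λ u → sumℕ (charge u)))) (ℕₚ.*-monoʳ-≤ 5 total-charge))))
    where
    open Approximation G k regular
    open Regular.Clustering G k regular lab

-- The simultaneous approximation guarantee.

open import Data.Nat using (ℕ; _*_; _≤_)
open import Data.Fin using (Fin)
open import Data.Fin.Subset using (Subset; ⊤)
open import Data.List using (List)
open import Data.Integer using (+_)
open import Data.Rational as ℚ using (ℚ; _/_)
open import Data.Product using (Σ; _×_; _,_)

theorem2 : Σ ℕ (λ c →
    (∀ (n : ℕ) (G : Instance n) → PositiveRegular G →
      ((lab : Fin n → Fin n) →
        fracCost G (corr G) ℚ.≤ ((+ c) / 1) ℚ.* ((+ ℓ₁ G (labelSC lab)) / 1))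
      ×
      ((Cs : List (Subset n)) → KMZRun (corr G) ⊤ Cs →
        ((lab : Fin n → Fin n) → ℓ₁ G (clustersSC Cs) ≤ c * ℓ₁ G (labelSC lab))
        ×
        ((lab : Fin n → Fin n) → ℓ∞ G (clustersSC Cs) ≤ c * ℓ∞ G (labelSC lab)))))
theorem2 = 35 , λ n G (k , regular) →
  fracCost-bound G k regular , λ Cs run → rounded-ℓ₁ G k regular run , rounded-ℓ∞ G k regular run
  where
  open CorrelationMetric
  open Approximation using (rounded-ℓ∞)
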